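{- Let $G$ be a $4K_1$-free graph that is minimally non-perfectly divisible. Then $G$ does not contain a clique cutset.
   Context: All graphs are finite and simple. For $S\subseteq V(G)$, $G[S]$ is the subgraph induced by $S$. $\omega(G)$ is the number of vertices in a largest clique of $G$ and $\chi(G)$ the chromatic number. A graph $G$ is perfect if $\chi(H)=\omega(H)$ for every induced subgraph $H$ of $G$. A partition $(A,B)$ of $V(G)$ is good if $G[A]$ is perfect and $\omega(G[B])<\omega(G)$. A graph $G$ is perfectly divisible if every induced subgraph $H$ of $G$ with at least one edge admits a good partition (of $V(H)$). A graph is minimally non-perfectly divisible if it is not perfectly divisible but each of its proper induced subgraphs is perfectly divisible. A set $C\subseteq V(G)$ is a clique cutset if $C$ induces a clique in $G$ and $G-C$ is disconnected. $4K_1$ is the edgeless graph on four vertices; $G$ is $4K_1$-free if it contains no stable set of size four. -}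

module Defs where

open import Level using (0ℓ)
open import Data.Nat using (ℕ; zero; suc; _≤_; _<_; _⊓_; z≤n; s≤s)
open import Data.Nat.Properties using (≤-pred; ≤∧≢⇒<; m⊓n≤n; m≤n⇒m⊓n≡m; <⇒≤; _<?_) renaming (_≟_ to _≟ℕ_)
open import Data.Fin using (Fin; toℕ; fromℕ<)
open import Data.Fin.Properties using (_≟_; all?; any?; toℕ<n; toℕ-fromℕ<; toℕ-injective)
open import Data.Fin.Subset using (Subset; _∈_; _⊆_; _⊂_; _∩_; _∪_; ∁; ∣_∣; Empty; ⊤; ⊥)
open import Data.Fin.Subset.Properties using (_∈?_; _⊆?_; anySubset?; ∣p∣≤n; ∉⊥; ⊥⊆; ∣⊥∣≡0)
open import Data.Vec using (Vec; []; _∷_; lookup; tabulate)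
open import Data.Vec.Properties using (lookup∘tabulate)
open import Data.Product using (∃; ∃₂; ∃-syntax; _×_; _,_; proj₁; proj₂)
open import Data.Empty using (⊥-elim)
open import Function using (_∘_)
open import Relation.Nullary using (¬_; Dec; yes; no)
open import Relation.Nullary.Decidable using (map′; _×-dec_; _→-dec_; ¬?)
open import Relation.Unary using (Pred; Decidable)
open import Relation.Binary using (Rel; Symmetric; Irreflexive) renaming (Decidable to Decidable₂)
open import Relation.Binary.Construct.Closure.ReflexiveTransitive using (Star)
open import Relation.Binary.PropositionalEquality using (_≡_; _≢_; refl; sym; trans; cong; subst; subst₂)

-- A finite simple graph with vertex set Fin n.  Its induced subgraphs are
-- represented by their vertex sets: a predicate or invariant taking G and
-- S : Subset n is that of G[S], and S = ⊤ gives G itself.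
record Graph (n : ℕ) : Set₁ where
  field
    Adj        : Rel (Fin n) 0ℓ
    adj?       : Decidable₂ Adj
    adj-sym    : Symmetric Adj
    adj-irrefl : Irreflexive _≡_ Adj

open Graph public

private
  variable
    n : ℕ

IsClique : Graph n → Subset n → Set
IsClique G K = ∀ u v → u ∈ K → v ∈ K → u ≢ v → Adj G u v

IsStable : Graph n → Subset n → Set
IsStable G K = ∀ u v → u ∈ K → v ∈ K → ¬ Adj G u v

HasClique : Graph n → Subset n → ℕ → Set
HasClique G S k = ∃[ K ] (K ⊆ S × IsClique G K × ∣ K ∣ ≡ k)

-- Only the colours of vertices in S matter.  Colours are natural numbers so
-- that the empty induced subgraph is 0-colourable even when n > 0.
IsColouring : Graph n → Subset n → ℕ → (Fin n → ℕ) → Set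
IsColouring G S k c =
  (∀ v → v ∈ S → c v < k) ×
  (∀ u v → u ∈ S → v ∈ S → Adj G u v → c u ≢ c v)

Colourable : Graph n → Subset n → ℕ → Set
Colourable G S k = ∃[ c ] IsColouring G S k c

IsGreatest : Pred ℕ 0ℓ → ℕ → Set
IsGreatest P k = P k × (∀ j → P j → j ≤ k)

IsLeast : Pred ℕ 0ℓ → ℕ → Set
IsLeast P k = P k × (∀ j → P j → k ≤ j)

private
  greatest : {P : Pred ℕ 0ℓ} → Decidable P → P 0 →
             ∀ m → (∀ j → P j → j ≤ m) → ∃ (IsGreatest P)
  greatest P? p0 zero    bd = 0 , p0 , bd
  greatest {P} P? p0 (suc m) bd with P? (suc m)
  ... | yes p = suc m , p , bd
  ... | no ¬p = greatest P? p0 m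
    (λ j pj → ≤-pred (≤∧≢⇒< (bd j pj) (λ eq → ¬p (subst P eq pj))))

  least : {P : Pred ℕ 0ℓ} → Decidable P → ∀ m → P m → ∃ (IsLeast P)
  least {P} P? m p with P? 0
  least {P} P? m       p | yes p0 = 0 , p0 , λ _ _ → z≤n
  least {P} P? zero    p | no ¬p0 = ⊥-elim (¬p0 p)
  least {P} P? (suc m) p | no ¬p0 with least {P ∘ suc} (P? ∘ suc) m p
  ... | k , pk , lo = suc k , pk , lo′
    where
    lo′ : ∀ j → P j → suc k ≤ j
    lo′ zero    pj = ⊥-elim (¬p0 pj)
    lo′ (suc j) pj = s≤s (lo j pj)

  anyVec? : ∀ {k} m {P : Pred (Vec (Fin k) m) 0ℓ} → Decidable P → Dec (∃ P)
  anyVec? zero    P? = map′ (λ p → [] , p) (λ { ([] , p) → p }) (P? [])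
  anyVec? (suc m) P? =
    map′ (λ (x , xs , p) → x ∷ xs , p) (λ { (x ∷ xs , p) → x , xs , p })
      (any? (λ x → anyVec? m (P? ∘ (x ∷_))))

  isClique? : (G : Graph n) → Decidable (IsClique G)
  isClique? G K = all? λ u → all? λ v →
    (u ∈? K) →-dec (v ∈? K) →-dec ¬? (u ≟ v) →-dec adj? G u v

  hasClique? : (G : Graph n) (S : Subset n) → Decidable (HasClique G S)
  hasClique? G S k = anySubset? λ K →
    (K ⊆? S) ×-dec isClique? G K ×-dec (∣ K ∣ ≟ℕ k)

  isColouring? : (G : Graph n) (S : Subset n) (k : ℕ) → Decidable (IsColouring G S k)
  isColouring? G S k c =
    (all? λ v → (v ∈? S) →-dec (c v <? k)) ×-dec
    (all? λ u → all? λ v →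
      (u ∈? S) →-dec (v ∈? S) →-dec adj? G u v →-dec ¬? (c u ≟ℕ c v))

  colourable? : (G : Graph n) (S : Subset n) → Decidable (Colourable G S)
  colourable? {n} G S k =
    map′ (λ (xs , p) → colours xs , p) truncate
      (anyVec? n (isColouring? G S k ∘ colours))
    where
    colours : Vec (Fin (suc k)) n → Fin n → ℕ
    colours xs = toℕ ∘ lookup xs

    truncate : Colourable G S k → ∃ (IsColouring G S k ∘ colours)
    truncate (c , bd , proper) = xs ,
      (λ v v∈S → subst (_< k) (sym (agree v v∈S)) (bd v v∈S)) ,
      (λ u v u∈S v∈S uv →
        subst₂ _≢_ (sym (agree u u∈S)) (sym (agree v v∈S)) (proper u v u∈S v∈S uv))
      where
      f : Fin n → Fin (suc k)
      f v = fromℕ< (s≤s (m⊓n≤n (c v) k))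

      xs : Vec (Fin (suc k)) n
      xs = tabulate f

      agree : ∀ v → v ∈ S → colours xs v ≡ c v
      agree v v∈S = trans (cong toℕ (lookup∘tabulate f v))
        (trans (toℕ-fromℕ< _) (m≤n⇒m⊓n≡m (<⇒≤ (bd v v∈S))))

abstract
  cliqueNumber : (G : Graph n) (S : Subset n) → ∃[ k ] IsGreatest (HasClique G S) k
  cliqueNumber {n} G S = greatest (hasClique? G S)
    (⊥ , ⊥⊆ , (λ _ _ u∈⊥ → ⊥-elim (∉⊥ u∈⊥)) , ∣⊥∣≡0 n)
    n (λ { _ (K , _ , _ , refl) → ∣p∣≤n K })

  chromaticNumber : (G : Graph n) (S : Subset n) → ∃[ k ] IsLeast (Colourable G S) k
  chromaticNumber {n} G S = least (colourable? G S) n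
    (toℕ , (λ v _ → toℕ<n v) ,
      λ u v _ _ uv eq → adj-irrefl G (toℕ-injective eq) uv)

ω : Graph n → Subset n → ℕ
ω G S = proj₁ (cliqueNumber G S)

χ : Graph n → Subset n → ℕ
χ G S = proj₁ (chromaticNumber G S)

ω-spec : (G : Graph n) (S : Subset n) → IsGreatest (HasClique G S) (ω G S)
ω-spec G S = proj₂ (cliqueNumber G S)

χ-spec : (G : Graph n) (S : Subset n) → IsLeast (Colourable G S) (χ G S)
χ-spec G S = proj₂ (chromaticNumber G S)

Perfect : Graph n → Subset n → Set
Perfect G S = ∀ T → T ⊆ S → χ G T ≡ ω G T

IsPartition : Subset n → Subset n → Subset n → Set
IsPartition S A B = A ∪ B ≡ S × Empty (A ∩ B)

GoodPartition : Graph n → Subset n → Subset n → Subset n → Set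
GoodPartition G S A B = IsPartition S A B × Perfect G A × ω G B < ω G S

HasEdge : Graph n → Subset n → Set
HasEdge G S = ∃₂ λ u v → u ∈ S × v ∈ S × Adj G u v

PerfectlyDivisible : Graph n → Subset n → Set
PerfectlyDivisible G S =
  ∀ T → T ⊆ S → HasEdge G T → ∃₂ λ A B → GoodPartition G T A B

MinimallyNonPerfectlyDivisible : Graph n → Set
MinimallyNonPerfectlyDivisible G =
  ¬ PerfectlyDivisible G ⊤ × (∀ S → S ⊂ ⊤ → PerfectlyDivisible G S)

AdjIn : Graph n → Subset n → Rel (Fin n) 0ℓ
AdjIn G S u v = u ∈ S × v ∈ S × Adj G u v

-- The empty graph counts as connected, so that V(G) is never a cutset.
Connected : Graph n → Subset n → Set
Connected G S = ∀ u v → u ∈ S → v ∈ S → Star (AdjIn G S) u v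

IsCliqueCutset : Graph n → Subset n → Set
IsCliqueCutset G C = IsClique G C × ¬ Connected G (∁ C)

4K₁-Free : Graph n → Set
4K₁-Free G = ¬ (∃[ S ] (IsStable G S × ∣ S ∣ ≡ 4))

{-# OPTIONS --safe #-}

-- Since G is 4K₁-free, one side X of the clique cutset C is a clique.  If A is
-- disjoint from X, G[A] is perfect and all neighbours of X in A lie in C, then
-- G[A ∪ X] is perfect: for an induced subgraph T, colour T ∩ A with ω(T)
-- colours and extend to T ∩ X by Hall's theorem.  The colours forbidden to all
-- of X′ ⊆ T ∩ X are those of the common neighbours of X′ in T ∩ A ∩ C, and these
-- form a clique together with X′, which is exactly Hall's condition.  Hence a
-- good partition (A , B) of V ∖ X yields the good partition (A ∪ X , B) of V;
-- if V ∖ X has no edge, then G itself is perfect.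

module Submission where

open import Data.Nat using (ℕ; zero; suc; _+_; _∸_; _≤_; _<_; z≤n; s≤s)
open import Data.Nat.Properties hiding (suc-injective) renaming (_≟_ to _≟ℕ_)
open import Data.Fin using (Fin; zero; suc; toℕ; fromℕ<)
open import Data.Fin.Properties using (_≟_; any?; all?; toℕ<n; toℕ-injective; toℕ-fromℕ<; suc-injective; sequence)
open import Data.Fin.Subset
open import Data.Fin.Subset.Properties
open import Data.Fin.Subset.Induction using (Acc; acc; ⊂-wellFounded)
open import Data.Vec using ([]; _∷_; here; there; tabulate)
open import Data.Vec.Properties using (lookup∘tabulate; []=⇒lookup; lookup⇒[]=)
open import Data.Bool using (if_then_else_)
open import Data.Product using (∃; ∃₂; ∃-syntax; _×_; _,_; proj₁; proj₂)
open import Data.Sum using (_⊎_; inj₁; inj₂)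
import Data.Empty
open import Effect.Monad using (RawMonad)
open import Function using (_∘_; const)
open import Level using (0ℓ)
open import Relation.Nullary using (¬_; Dec; yes; no; does; contradiction)
open import Relation.Nullary.Decidable using (_×-dec_; _→-dec_; ¬?; decidable-stable; dec-true; ¬¬-excluded-middle)
open import Relation.Nullary.Negation using (¬¬-Monad)
open import Relation.Unary using (Pred; Decidable)
open import Relation.Binary using () renaming (Decidable to Decidable₂)
open import Relation.Binary.Construct.Closure.ReflexiveTransitive using (Star; ε; _◅_; _◅◅_)
open import Relation.Binary.PropositionalEquality using (_≡_; _≢_; refl; sym; trans; cong; cong₂; subst)
open import Defs

private
  variable
    m n : ℕ

-- Finite subsets

⟦_⟧ : {P : Pred (Fin n) 0ℓ} → Decidable P → Subset n
⟦ P? ⟧ = tabulate (does ∘ P?)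

∈⟦⟧⁺ : {P : Pred (Fin n) 0ℓ} (P? : Decidable P) → ∀ {x} → P x → x ∈ ⟦ P? ⟧
∈⟦⟧⁺ P? {x} px = lookup⇒[]= x _ (trans (lookup∘tabulate _ x) (dec-true (P? x) px))

∈⟦⟧⁻ : {P : Pred (Fin n) 0ℓ} (P? : Decidable P) → ∀ {x} → x ∈ ⟦ P? ⟧ → P x
∈⟦⟧⁻ P? {x} x∈ with P? x in eq
... | yes px = px
... | no _   = contradiction
  (trans (sym ([]=⇒lookup x∈)) (trans (lookup∘tabulate _ x) (cong does eq))) λ ()

x∈p─q⇒x∉q : ∀ (p q : Subset n) {x} → x ∈ p ─ q → x ∉ q
x∈p─q⇒x∉q (_ ∷ p) (inside  ∷ q) () here
x∈p─q⇒x∉q (_ ∷ p) (_ ∷ q) (there x∈) (there x∈q) = x∈p─q⇒x∉q p q x∈ x∈q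

∣p∪q∣≤∣p∣+∣q∣ : ∀ (p q : Subset n) → ∣ p ∪ q ∣ ≤ ∣ p ∣ + ∣ q ∣
∣p∪q∣≤∣p∣+∣q∣ [] [] = z≤n
∣p∪q∣≤∣p∣+∣q∣ (inside ∷ p) (y ∷ q) =
  s≤s (≤-trans (∣p∪q∣≤∣p∣+∣q∣ p q) (+-monoʳ-≤ ∣ p ∣ (∣p∣≤∣x∷p∣ y q)))
∣p∪q∣≤∣p∣+∣q∣ (outside ∷ p) (inside ∷ q) =
  ≤-trans (s≤s (∣p∪q∣≤∣p∣+∣q∣ p q)) (≤-reflexive (sym (+-suc ∣ p ∣ ∣ q ∣)))
∣p∪q∣≤∣p∣+∣q∣ (outside ∷ p) (outside ∷ q) = ∣p∪q∣≤∣p∣+∣q∣ p q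

disjoint⇒∣p∪q∣≡∣p∣+∣q∣ : ∀ (p q : Subset n) → (∀ {x} → x ∈ p → x ∉ q) →
                        ∣ p ∪ q ∣ ≡ ∣ p ∣ + ∣ q ∣
disjoint⇒∣p∪q∣≡∣p∣+∣q∣ [] [] _ = refl
disjoint⇒∣p∪q∣≡∣p∣+∣q∣ (inside ∷ p) (inside ∷ q) dis = contradiction here (dis here)
disjoint⇒∣p∪q∣≡∣p∣+∣q∣ (inside ∷ p) (outside ∷ q) dis =
  cong suc (disjoint⇒∣p∪q∣≡∣p∣+∣q∣ p q λ x∈p → dis (there x∈p) ∘ there)
disjoint⇒∣p∪q∣≡∣p∣+∣q∣ (outside ∷ p) (inside ∷ q) dis =
  trans (cong suc (disjoint⇒∣p∪q∣≡∣p∣+∣q∣ p q λ x∈p → dis (there x∈p) ∘ there))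
        (sym (+-suc ∣ p ∣ ∣ q ∣))
disjoint⇒∣p∪q∣≡∣p∣+∣q∣ (outside ∷ p) (outside ∷ q) dis =
  disjoint⇒∣p∪q∣≡∣p∣+∣q∣ p q λ x∈p → dis (there x∈p) ∘ there

-- By induction on `p`: the partner of the first element is deleted from `q`, and injectivity of `R`
-- keeps the partners of later elements away from it.
injective-relation⇒∣p∣≤∣q∣ : (R : Fin m → Fin n → Set) (p : Subset m) (q : Subset n) →
  (∀ x → x ∈ p → ∃[ y ] (y ∈ q × R x y)) →
  (∀ {x x′ y} → R x y → R x′ y → x ≡ x′) → ∣ p ∣ ≤ ∣ q ∣
injective-relation⇒∣p∣≤∣q∣ R [] q total inj = z≤n
injective-relation⇒∣p∣≤∣q∣ R (outside ∷ p) q total inj =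
  injective-relation⇒∣p∣≤∣q∣ (R ∘ suc) p q (λ x x∈p → total (suc x) (there x∈p))
    λ r r′ → suc-injective (inj r r′)
injective-relation⇒∣p∣≤∣q∣ R (inside ∷ p) q total inj with total zero here
... | y , y∈q , r = ≤-trans (s≤s
  (injective-relation⇒∣p∣≤∣q∣ (R ∘ suc) p (q - y) total′
    λ s s′ → suc-injective (inj s s′))) (x∈p⇒∣p-x∣<∣p∣ y∈q)
  where
  total′ : ∀ x → x ∈ p → ∃[ z ] (z ∈ q - y × R (suc x) z)
  total′ x x∈p with total (suc x) (there x∈p)
  ... | z , z∈q , s = z , x∈p∧x≢y⇒x∈p-y z∈q
    (λ { refl → contradiction (inj r s) λ () }) , s

0<∣p∣⇒Nonempty : (p : Subset n) → 0 < ∣ p ∣ → Nonempty p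
0<∣p∣⇒Nonempty (inside  ∷ p) _   = zero , here
0<∣p∣⇒Nonempty (outside ∷ p) 0<p with 0<∣p∣⇒Nonempty p 0<p
... | x , x∈p = suc x , there x∈p

Empty⇒∣p∣≤k : (p : Subset n) → Empty p → ∀ {k} → ∣ p ∣ ≤ k
Empty⇒∣p∣≤k p empty = ≮⇒≥ λ k<p → empty (0<∣p∣⇒Nonempty p (≤-trans (s≤s z≤n) k<p))

-- Hall's theorem

-- Matchings are total functions whose values outside `S` are irrelevant; `default` supplies them
-- when `S` is empty. The set `W` of available partners is an argument because the induction uses
-- partners up.
module Hall {R : Fin m → Fin n → Set} (R? : Decidable₂ R) (default : Fin n) where

  neighbour? : (S : Subset m) (W : Subset n) →
               Decidable λ y → y ∈ W × ∃[ x ] (x ∈ S × R x y)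
  neighbour? S W y = (y ∈? W) ×-dec any? λ x → (x ∈? S) ×-dec R? x y

  Γ : Subset m → Subset n → Subset n
  Γ S W = ⟦ neighbour? S W ⟧

  HallCondition : Subset m → Subset n → Set
  HallCondition S W = ∀ S′ → S′ ⊆ S → ∣ S′ ∣ ≤ ∣ Γ S′ W ∣

  IsMatching : Subset m → Subset n → (Fin m → Fin n) → Set
  IsMatching S W f = (∀ x → x ∈ S → f x ∈ W × R x (f x)) ×
                     (∀ x y → x ∈ S → y ∈ S → f x ≡ f y → x ≡ y)

  Γ-─ : ∀ S W V → Γ S W ⊆ Γ S (W ─ V) ∪ V
  Γ-─ S W V {y} y∈ with y ∈? V | ∈⟦⟧⁻ (neighbour? S W) y∈
  ... | yes y∈V | _ = q⊆p∪q _ V y∈V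
  ... | no  y∉V | y∈W , x , x∈S , r = p⊆p∪q V (∈⟦⟧⁺ (neighbour? S (W ─ V))
                        (x∈p∧x∉q⇒x∈p─q y∈W y∉V , x , x∈S , r))

  -- A neighbour of `S ∪ T` that is not a neighbour of `T` can only come from `S`. This preserves
  -- Hall's condition when a tight `T` is removed together with its neighbours.
  Γ-∪-─ : ∀ S T W → Γ (S ∪ T) W ⊆ Γ S (W ─ Γ T W) ∪ Γ T W
  Γ-∪-─ S T W y∈ with ∈⟦⟧⁻ (neighbour? (S ∪ T) W) y∈
  ... | y∈W , x , x∈ , r with x∈p∪q⁻ S T x∈
  ...   | inj₁ x∈S = Γ-─ S W (Γ T W) (∈⟦⟧⁺ (neighbour? S W) (y∈W , x , x∈S , r))
  ...   | inj₂ x∈T = q⊆p∪q _ (Γ T W) (∈⟦⟧⁺ (neighbour? T W) (y∈W , x , x∈T , r))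

  -- The two matchings cannot collide: `f` takes its values on `S′` inside `V`, while `g` avoids
  -- `V`.
  glue : ∀ {S S′ W V f g} → V ⊆ W → IsMatching S′ V f → IsMatching (S ─ S′) (W ─ V) g →
         ∃ (IsMatching S W)
  glue {S} {S′} {W} {V} {f} {g} V⊆W (f∈ , f-inj) (g∈ , g-inj) = h , h∈ , h-inj
    where
    h : Fin m → Fin n
    h x = if does (x ∈? S′) then f x else g x

    h∈ : ∀ x → x ∈ S → h x ∈ W × R x (h x)
    h∈ x x∈S with x ∈? S′
    ... | yes x∈S′ = V⊆W (proj₁ (f∈ x x∈S′)) , proj₂ (f∈ x x∈S′)
    ... | no  x∉S′ with g∈ x (x∈p∧x∉q⇒x∈p─q x∈S x∉S′)
    ...   | gx∈ , r = p─q⊆p W V gx∈ , r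

    f≢g : ∀ {x y} → x ∈ S′ → y ∈ S ─ S′ → f x ≢ g y
    f≢g {x} {y} x∈ y∈ eq = x∈p─q⇒x∉q W V (proj₁ (g∈ y y∈))
                             (subst (_∈ V) eq (proj₁ (f∈ x x∈)))

    h-inj : ∀ x y → x ∈ S → y ∈ S → h x ≡ h y → x ≡ y
    h-inj x y x∈S y∈S eq with x ∈? S′ | y ∈? S′
    ... | yes x∈ | yes y∈ = f-inj x y x∈ y∈ eq
    ... | yes x∈ | no  y∉ = contradiction eq (f≢g x∈ (x∈p∧x∉q⇒x∈p─q y∈S y∉))
    ... | no  x∉ | yes y∈ = contradiction (sym eq) (f≢g y∈ (x∈p∧x∉q⇒x∈p─q x∈S x∉))
    ... | no  x∉ | no  y∉ =
      g-inj x y (x∈p∧x∉q⇒x∈p─q x∈S x∉) (x∈p∧x∉q⇒x∈p─q y∈S y∉) eq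

  private
    -- Under Hall's condition the inequality is an equality. Properness makes `S′` smaller than `S`,
    -- and nonemptiness makes `S ─ S′` smaller, so both recursive calls are well founded.
    Tight : Subset m → Subset n → Pred (Subset m) 0ℓ
    Tight S W S′ = S′ ⊂ S × Nonempty S′ × ∣ Γ S′ W ∣ ≤ ∣ S′ ∣

    tight? : ∀ S W → Dec (∃ (Tight S W))
    tight? S W = anySubset? λ S′ → (S′ ⊂? S) ×-dec nonempty? S′ ×-dec (∣ Γ S′ W ∣ ≤? ∣ S′ ∣)

    -- Halmos–Vaughan: match a tight subset separately if there is one;
    -- otherwise any edge may be used.
    matching : ∀ S W → Acc _⊂_ S → HallCondition S W → ∃ (IsMatching S W)
    matching S W (acc rec) hall with nonempty? S
    ... | no S-empty = const default ,
      (λ x x∈S → contradiction (x , x∈S) S-empty) ,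
      (λ x _ x∈S → contradiction (x , x∈S) S-empty)
    ... | yes (x , x∈S) with tight? S W
    ...   | yes (S′ , S′⊂S , (z , z∈S′) , Γ≤S′) =
      glue (proj₁ ∘ ∈⟦⟧⁻ (neighbour? S′ W)) first′ (proj₂ second)
      where
      S′⊆S : S′ ⊆ S
      S′⊆S = p⊂q⇒p⊆q S′⊂S

      first : ∃ (IsMatching S′ W)
      first = matching S′ W (rec S′⊂S) λ S″ S″⊆S′ → hall S″ (⊆-trans S″⊆S′ S′⊆S)

      -- The target shrinks to `Γ S′ W`, leaving everything else in `W` for `S ─ S′`.
      first′ : IsMatching S′ (Γ S′ W) (proj₁ first)
      first′ with first
      ... | _ , f∈ , f-inj = (λ y y∈ → ∈⟦⟧⁺ (neighbour? S′ W)
        (proj₁ (f∈ y y∈) , y , y∈ , proj₂ (f∈ y y∈)) , proj₂ (f∈ y y∈)) , f-inj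

      -- Hall's condition for `S″ ∪ S′` is used; tightness says that `S′` accounts for at most
      -- `∣ S′ ∣` of the neighbours, which then cancel.
      hall′ : HallCondition (S ─ S′) (W ─ Γ S′ W)
      hall′ S″ S″⊆ = +-cancelʳ-≤ ∣ S′ ∣ _ _ (begin
        ∣ S″ ∣ + ∣ S′ ∣                        ≡⟨ disjoint⇒∣p∪q∣≡∣p∣+∣q∣ S″ S′ (x∈p─q⇒x∉q S S′ ∘ S″⊆) ⟨
        ∣ S″ ∪ S′ ∣                            ≤⟨ hall (S″ ∪ S′) ∪⊆S ⟩
        ∣ Γ (S″ ∪ S′) W ∣                      ≤⟨ p⊆q⇒∣p∣≤∣q∣ (Γ-∪-─ S″ S′ W) ⟩
        ∣ Γ S″ (W ─ Γ S′ W) ∪ Γ S′ W ∣         ≤⟨ ∣p∪q∣≤∣p∣+∣q∣ (Γ S″ (W ─ Γ S′ W)) (Γ S′ W) ⟩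
        ∣ Γ S″ (W ─ Γ S′ W) ∣ + ∣ Γ S′ W ∣     ≤⟨ +-monoʳ-≤ _ Γ≤S′ ⟩
        ∣ Γ S″ (W ─ Γ S′ W) ∣ + ∣ S′ ∣         ∎)
        where
        open ≤-Reasoning
        ∪⊆S : S″ ∪ S′ ⊆ S
        ∪⊆S y∈ with x∈p∪q⁻ S″ S′ y∈
        ... | inj₁ y∈S″ = p─q⊆p S S′ (S″⊆ y∈S″)
        ... | inj₂ y∈S′ = S′⊆S y∈S′

      second : ∃ (IsMatching (S ─ S′) (W ─ Γ S′ W))
      second = matching (S ─ S′) (W ─ Γ S′ W)
        (rec (p∩q≢∅⇒p─q⊂p S S′ (z , x∈p∩q⁺ (S′⊆S z∈S′ , z∈S′)))) hall′
    -- Hall's condition on the singleton of `x` provides an edge from `x` to some `y`.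
    ...   | no ¬tight with 0<∣p∣⇒Nonempty (Γ ⁅ x ⁆ W)
              (≤-trans (≤-reflexive (sym (∣⁅x⁆∣≡1 x))) (hall ⁅ x ⁆ λ y∈ → subst (_∈ S) (sym (x∈⁅y⁆⇒x≡y x y∈)) x∈S))
    ...     | y , y∈Γ with ∈⟦⟧⁻ (neighbour? ⁅ x ⁆ W) y∈Γ
    ...       | y∈W , x′ , x′∈ , r with x∈⁅y⁆⇒x≡y x x′∈
    ...         | refl = glue {V = ⁅ y ⁆} (λ z∈ → subst (_∈ W) (sym (x∈⁅y⁆⇒x≡y y z∈)) y∈W)
                           first (proj₂ second)
      where
      first : IsMatching ⁅ x ⁆ ⁅ y ⁆ (const y)
      first =
        (λ z z∈ → x∈⁅x⁆ y , subst (λ w → R w y) (sym (x∈⁅y⁆⇒x≡y x z∈)) r) ,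
        (λ z w z∈ w∈ _ → trans (x∈⁅y⁆⇒x≡y x z∈) (sym (x∈⁅y⁆⇒x≡y x w∈)))

      hall′ : HallCondition (S - x) (W - y)
      hall′ S″ S″⊆ with nonempty? S″
      ... | no empty = Empty⇒∣p∣≤k S″ empty
      -- Since `S″` is nonempty, proper in `S` and not tight, it has at least one neighbour to
      -- spare, so `y` can be given up.
      ... | yes ne = +-cancelʳ-≤ 1 _ _ (begin
        ∣ S″ ∣ + 1                       ≡⟨ +-comm ∣ S″ ∣ 1 ⟩
        suc ∣ S″ ∣                       ≤⟨ ≰⇒> (λ ≤ → ¬tight (S″ , ⊆-⊂-trans S″⊆ (x∈p⇒p-x⊂p x∈S) , ne , ≤)) ⟩
        ∣ Γ S″ W ∣                       ≤⟨ p⊆q⇒∣p∣≤∣q∣ (Γ-─ S″ W ⁅ y ⁆) ⟩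
        ∣ Γ S″ (W - y) ∪ ⁅ y ⁆ ∣         ≤⟨ ∣p∪q∣≤∣p∣+∣q∣ (Γ S″ (W - y)) ⁅ y ⁆ ⟩
        ∣ Γ S″ (W - y) ∣ + ∣ ⁅ y ⁆ ∣     ≡⟨ cong (∣ Γ S″ (W - y) ∣ +_) (∣⁅x⁆∣≡1 y) ⟩
        ∣ Γ S″ (W - y) ∣ + 1             ∎)
        where open ≤-Reasoning

      second : ∃ (IsMatching (S - x) (W - y))
      second = matching (S - x) (W - y) (rec (x∈p⇒p-x⊂p x∈S)) hall′

  hall-theorem : ∀ S W → HallCondition S W → ∃ (IsMatching S W)
  hall-theorem S W = matching S W (⊂-wellFounded S)

-- Cliques, colourings and perfect graphs

module _ (G : Graph n) where

  isClique-∪ : ∀ {K L} → IsClique G K → IsClique G L →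
               (∀ x y → x ∈ K → y ∈ L → Adj G x y) → IsClique G (K ∪ L)
  isClique-∪ {K} {L} cK cL cKL u v u∈ v∈ u≢v with x∈p∪q⁻ K L u∈ | x∈p∪q⁻ K L v∈
  ... | inj₁ u∈K | inj₁ v∈K = cK u v u∈K v∈K u≢v
  ... | inj₁ u∈K | inj₂ v∈L = cKL u v u∈K v∈L
  ... | inj₂ u∈L | inj₁ v∈K = adj-sym G (cKL v u v∈K u∈L)
  ... | inj₂ u∈L | inj₂ v∈L = cL u v u∈L v∈L u≢v

  isClique-⊆ : ∀ {K L} → K ⊆ L → IsClique G L → IsClique G K
  isClique-⊆ K⊆L cL u v u∈ v∈ = cL u v (K⊆L u∈) (K⊆L v∈)

  clique≤ω : ∀ {S K} → K ⊆ S → IsClique G K → ∣ K ∣ ≤ ω G S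
  clique≤ω {S} {K} K⊆S cK = proj₂ (ω-spec G S) ∣ K ∣ (K , K⊆S , cK , refl)

  ω-mono : ∀ {S T} → S ⊆ T → ω G S ≤ ω G T
  ω-mono {S} {T} S⊆T with proj₁ (ω-spec G S)
  ... | K , K⊆S , cK , ∣K∣≡ω = proj₂ (ω-spec G T) _ (K , ⊆-trans K⊆S S⊆T , cK , ∣K∣≡ω)

  x∈S⇒0<ω : ∀ {S x} → x ∈ S → 0 < ω G S
  x∈S⇒0<ω {S} {x} x∈S = subst (_≤ ω G S) (∣⁅x⁆∣≡1 x)
    (clique≤ω (λ y∈ → subst (_∈ S) (sym (x∈⁅y⁆⇒x≡y x y∈)) x∈S)
      λ u v u∈ v∈ u≢v → contradiction (trans (x∈⁅y⁆⇒x≡y x u∈) (sym (x∈⁅y⁆⇒x≡y x v∈))) u≢v)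

  ω⊥≡0 : ω G ⊥ ≡ 0
  ω⊥≡0 with proj₁ (ω-spec G ⊥)
  ... | K , K⊆⊥ , _ , ∣K∣≡ω = n≤0⇒n≡0 (subst (_≤ 0) ∣K∣≡ω
    (Empty⇒∣p∣≤k K λ (_ , x∈K) → ∉⊥ (K⊆⊥ x∈K)))

  clique≤colours : ∀ {S K k} → K ⊆ S → IsClique G K → Colourable G S k → ∣ K ∣ ≤ k
  clique≤colours {S} {K} {k} K⊆S cK (c , bd , proper) =
    ≤-trans (injective-relation⇒∣p∣≤∣q∣ R K ⊤
      (λ x x∈K → fromℕ< (bd x (K⊆S x∈K)) , ∈⊤ , x∈K , sym (toℕ-fromℕ< _)) inj)
      (≤-reflexive (∣⊤∣≡n k))
    where
    R : Fin n → Fin k → Set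
    -- Membership in `K` belongs to the relation because the colouring separates vertices only
    -- within the clique.
    R x j = x ∈ K × c x ≡ toℕ j

    inj : ∀ {x x′ j} → R x j → R x′ j → x ≡ x′
    inj {x} {x′} (x∈K , cx) (x′∈K , cx′) with x ≟ x′
    ... | yes eq = eq
    ... | no  ne = contradiction (trans cx (sym cx′))
      (proper x x′ (K⊆S x∈K) (K⊆S x′∈K) (cK x x′ x∈K x′∈K ne))

  -- A largest clique already forces `ω G S` colours, so perfection reduces to exhibiting
  -- colourings.
  colourable-ω⇒χ≡ω : ∀ {S} → Colourable G S (ω G S) → χ G S ≡ ω G S
  colourable-ω⇒χ≡ω {S} col with proj₁ (ω-spec G S)
  ... | K , K⊆S , cK , ∣K∣≡ω = ≤-antisym (proj₂ (χ-spec G S) _ col)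
    (subst (_≤ χ G S) ∣K∣≡ω (clique≤colours K⊆S cK (proj₁ (χ-spec G S))))

  edgeless⇒perfect : ∀ {S} → ¬ HasEdge G S → Perfect G S
  -- Any vertex of `T` makes `ω G T` positive, so colour 0 is within bounds there; the empty `T` is
  -- covered as well.
  edgeless⇒perfect ¬edge T T⊆S = colourable-ω⇒χ≡ω (const 0 , (λ v → x∈S⇒0<ω) ,
    λ u v u∈T v∈T uv → contradiction (u , v , T⊆S u∈T , T⊆S v∈T , uv) ¬edge)

  colourable-mono : ∀ {S j k} → j ≤ k → Colourable G S j → Colourable G S k
  colourable-mono j≤k (c , bd , proper) = c , (λ v v∈S → ≤-trans (bd v v∈S) j≤k) , proper

  -- The number of colours is a variable `k` rather than `ω G T` so that it can be split: for
  -- `k = 0` the set `T` is empty, and otherwise the colours form `Fin (suc k)`, whose `zero` serves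
  -- as Hall's default.
  extend-colouring : ∀ {A X C T k} → IsClique G X → IsClique G C →
    (∀ x a → x ∈ X → a ∈ A → Adj G x a → a ∈ C) → (∀ {x} → x ∈ A → x ∉ X) →
    T ⊆ A ∪ X → ω G T ≤ k → Colourable G (T ∩ A) k → Colourable G T k
  extend-colouring {T = T} {k = zero} _ _ _ _ _ ω≤0 _ = const 0 ,
    (λ v v∈T → ≤-trans (x∈S⇒0<ω v∈T) ω≤0) ,
    (λ u v u∈T _ _ → contradiction (≤-trans (x∈S⇒0<ω u∈T) ω≤0) λ ())
  extend-colouring {A} {X} {C} {T} {suc k} cX cC N⊆C A∩X=∅ T⊆ ω≤k (c , bd , proper) =
    d , d-bd , d-proper
    where
    Blocked : Fin n → Fin (suc k) → Set
    Blocked x j = ∃[ y ] (y ∈ T ∩ A × Adj G x y × c y ≡ toℕ j)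

    blocked? : Decidable₂ Blocked
    blocked? x j = any? λ y → (y ∈? T ∩ A) ×-dec adj? G x y ×-dec (c y ≟ℕ toℕ j)

    -- Vertices are matched to colours not blocked for them. Thus `Γ X′ ⊤` holds the colours free
    -- for some vertex of `X′`, and its complement those blocked for all of `X′`.
    open Hall (λ x j → ¬? (blocked? x j)) zero

    module _ (X′ : Subset n) (X′⊆ : X′ ⊆ T ∩ X) where
      common? : Decidable λ y → (y ∈ T ∩ A × y ∈ C) × (∀ x → x ∈ X′ → Adj G x y)
      common? y = ((y ∈? T ∩ A) ×-dec (y ∈? C)) ×-dec all? λ x → (x ∈? X′) →-dec adj? G x y

      Common : Subset n
      Common = ⟦ common? ⟧

      X′⊆T : X′ ⊆ T
      X′⊆T = p∩q⊆p T X ∘ X′⊆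

      X′⊆X : X′ ⊆ X
      X′⊆X = p∩q⊆q T X ∘ X′⊆

      X′∪Common-clique : IsClique G (X′ ∪ Common)
      X′∪Common-clique = isClique-∪ (isClique-⊆ X′⊆X cX)
        (isClique-⊆ (proj₂ ∘ proj₁ ∘ ∈⟦⟧⁻ common?) cC)
        (λ x y x∈ y∈ → proj₂ (∈⟦⟧⁻ common? y∈) x x∈)

      X′∪Common⊆T : X′ ∪ Common ⊆ T
      X′∪Common⊆T v∈ with x∈p∪q⁻ X′ Common v∈
      ... | inj₁ v∈X′ = X′⊆T v∈X′
      ... | inj₂ v∈Co = p∩q⊆p T A (proj₁ (proj₁ (∈⟦⟧⁻ common? v∈Co)))

      disjoint : ∀ {x} → x ∈ X′ → x ∉ Common
      disjoint x∈X′ x∈Co = A∩X=∅ (p∩q⊆q T A (proj₁ (proj₁ (∈⟦⟧⁻ common? x∈Co)))) (X′⊆X x∈X′)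

      blocked : ∀ {j} → j ∈ ∁ (Γ X′ ⊤) → ∀ x → x ∈ X′ → Blocked x j
      blocked {j} j∈∁ x x∈ = decidable-stable (blocked? x j) λ free →
        x∈∁p⇒x∉p j∈∁ (∈⟦⟧⁺ (neighbour? X′ ⊤) (∈⊤ , x , x∈ , free))

      -- The vertex `x₀` fixes one blocking neighbour `y₀` and places it in `C`; it remains to see
      -- that `y₀` is adjacent to all of `X′`.
      forbidden : ∀ {x₀} → x₀ ∈ X′ → ∀ j → j ∈ ∁ (Γ X′ ⊤) → ∃[ y ] (y ∈ Common × c y ≡ toℕ j)
      forbidden {x₀} x₀∈ j j∈∁ with blocked j∈∁ x₀ x₀∈
      ... | y₀ , y₀∈ , adj₀ , c₀ = y₀ , ∈⟦⟧⁺ common? ((y₀∈ , y₀∈C) , adjacent) , c₀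
        where
        in-C : ∀ {x y} → x ∈ X′ → y ∈ T ∩ A → Adj G x y → y ∈ C
        in-C x∈ y∈ xy = N⊆C _ _ (X′⊆X x∈) (p∩q⊆q T A y∈) xy

        y₀∈C : y₀ ∈ C
        y₀∈C = in-C x₀∈ y₀∈ adj₀

        -- c is injective on the clique C, so the same y₀ blocks j for every x.
        adjacent : ∀ x → x ∈ X′ → Adj G x y₀
        adjacent x x∈ with blocked j∈∁ x x∈
        ... | y , y∈ , xy , cy with y ≟ y₀
        ...   | yes refl = xy
        ...   | no  y≢y₀ = contradiction (trans cy (sym c₀))
          (proper y y₀ y∈ y₀∈ (cC y y₀ (in-C x∈ y∈ xy) y₀∈C y≢y₀))

      hall-inequality : ∣ X′ ∣ ≤ ∣ Γ X′ ⊤ ∣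
      hall-inequality with nonempty? X′
      ... | no empty = Empty⇒∣p∣≤k X′ empty
      ... | yes (x₀ , x₀∈) = +-cancelʳ-≤ ∣ Common ∣ _ _ (begin
        ∣ X′ ∣ + ∣ Common ∣                 ≡⟨ disjoint⇒∣p∪q∣≡∣p∣+∣q∣ X′ Common disjoint ⟨
        ∣ X′ ∪ Common ∣                     ≤⟨ clique≤ω X′∪Common⊆T X′∪Common-clique ⟩
        ω G T                               ≤⟨ ω≤k ⟩
        suc k                               ≤⟨ m≤n+m∸n (suc k) ∣ Γ X′ ⊤ ∣ ⟩
        ∣ Γ X′ ⊤ ∣ + (suc k ∸ ∣ Γ X′ ⊤ ∣)   ≤⟨ +-monoʳ-≤ _ few-forbidden ⟩
        ∣ Γ X′ ⊤ ∣ + ∣ Common ∣             ∎)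
        where
        open ≤-Reasoning
        -- Each forbidden colour is carried by a vertex of `Common`, and a vertex carries only one
        -- colour.
        few-forbidden : suc k ∸ ∣ Γ X′ ⊤ ∣ ≤ ∣ Common ∣
        few-forbidden = subst (_≤ ∣ Common ∣) (∣∁p∣≡n∸∣p∣ (Γ X′ ⊤))
          (injective-relation⇒∣p∣≤∣q∣ (λ j y → c y ≡ toℕ j) (∁ (Γ X′ ⊤)) Common (forbidden x₀∈)
            λ cy cy′ → toℕ-injective (trans (sym cy) cy′))

    matching : ∃ (IsMatching (T ∩ X) ⊤)
    matching = hall-theorem (T ∩ X) ⊤ hall-inequality

    f : Fin n → Fin (suc k)
    f = proj₁ matching

    d : Fin n → ℕ
    d v = if does (v ∈? X) then toℕ (f v) else c v

    in-A : ∀ {v} → v ∈ T → v ∉ X → v ∈ T ∩ A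
    in-A v∈T v∉X with x∈p∪q⁻ A X (T⊆ v∈T)
    ... | inj₁ v∈A = x∈p∩q⁺ (v∈T , v∈A)
    ... | inj₂ v∈X = contradiction v∈X v∉X

    d-bd : ∀ v → v ∈ T → d v < suc k
    d-bd v v∈T with v ∈? X
    ... | yes _  = toℕ<n (f v)
    ... | no v∉X = bd v (in-A v∈T v∉X)

    f-free : ∀ {x} → x ∈ T → x ∈ X → ¬ Blocked x (f x)
    f-free x∈T x∈X = proj₂ (proj₁ (proj₂ matching) _ (x∈p∩q⁺ (x∈T , x∈X)))

    d-proper : ∀ u v → u ∈ T → v ∈ T → Adj G u v → d u ≢ d v
    d-proper u v u∈T v∈T uv eq with u ∈? X | v ∈? X
    ... | yes u∈X | yes v∈X = adj-irrefl G (proj₂ (proj₂ matching) u v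
            (x∈p∩q⁺ (u∈T , u∈X)) (x∈p∩q⁺ (v∈T , v∈X)) (toℕ-injective eq)) uv
    ... | yes u∈X | no  v∉X = f-free u∈T u∈X (v , in-A v∈T v∉X , uv , sym eq)
    ... | no  u∉X | yes v∈X = f-free v∈T v∈X (u , in-A u∈T u∉X , adj-sym G uv , eq)
    ... | no  u∉X | no  v∉X = proper u v (in-A u∈T u∉X) (in-A v∈T v∉X) uv eq

  perfect-∪-clique : ∀ {A X C} → IsClique G X → IsClique G C →
    (∀ x a → x ∈ X → a ∈ A → Adj G x a → a ∈ C) → (∀ {x} → x ∈ A → x ∉ X) →
    Perfect G A → Perfect G (A ∪ X)
  perfect-∪-clique {A} cX cC N⊆C A∩X=∅ perfect T T⊆ = colourable-ω⇒χ≡ω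
    (extend-colouring cX cC N⊆C A∩X=∅ T⊆ ≤-refl
      (colourable-mono (≤-trans (≤-reflexive (perfect (T ∩ A) (p∩q⊆q T A))) (ω-mono (p∩q⊆p T A)))
        (proj₁ (χ-spec G (T ∩ A)))))

  hasEdge? : Decidable (HasEdge G)
  hasEdge? S = any? λ u → any? λ v → (u ∈? S) ×-dec (v ∈? S) ×-dec adj? G u v

  -- Minimally non-perfectly divisible graphs

  -- The complement of `X` is a proper induced subgraph, hence divisible. Moving `X` into the
  -- perfect part of its partition leaves `B` unchanged, while the clique number of the whole can
  -- only grow.
  clique-with-clique-attachment⇒⊥ : ∀ {X C} → MinimallyNonPerfectlyDivisible G →
    IsClique G X → Nonempty X → IsClique G C →
    (∀ x a → x ∈ X → a ∉ X → Adj G x a → a ∈ C) → Data.Empty.⊥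
  clique-with-clique-attachment⇒⊥ {X} {C} (¬divisible , minimal) cX (x , x∈X) cC N⊆C =
    ¬divisible divisible
    where
    ∁X⊂⊤ : ∁ X ⊂ ⊤
    ∁X⊂⊤ = ⊆⊤ , x , ∈⊤ , x∈p⇒x∉∁p x∈X

    perfect : ∀ {A} → A ⊆ ∁ X → Perfect G A → Perfect G (A ∪ X)
    perfect A⊆ = perfect-∪-clique cX cC
      (λ y a y∈X a∈A → N⊆C y a y∈X (x∈∁p⇒x∉p (A⊆ a∈A))) (x∈∁p⇒x∉p ∘ A⊆)

    good-partition : ∃₂ λ A B → GoodPartition G ⊤ A B
    good-partition with hasEdge? (∁ X)
    -- Minimality yields a partition only in the presence of an edge. Without one, `∁ X` is perfect,
    -- hence so is `G`, and `B` may be empty; `x` ensures that `ω G ⊤` is positive.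
    ... | no ¬edge = ⊤ , ⊥ ,
      ( ∪-identityʳ ⊤
      , λ (y , y∈) → ∉⊥ (p∩q⊆q ⊤ ⊥ y∈)) ,
      subst (Perfect G) (trans (∪-comm (∁ X) X) (p∪∁p≡⊤ X)) (perfect ⊆-refl (edgeless⇒perfect ¬edge)) ,
      subst (_< ω G ⊤) (sym ω⊥≡0) (x∈S⇒0<ω {x = x} ∈⊤)
    ... | yes edge with minimal (∁ X) ∁X⊂⊤ (∁ X) ⊆-refl edge
    ...   | A , B , (A∪B≡∁X , A∩B=∅) , A-perfect , ωB<ω = A ∪ X , B , (cover , disjoint) ,
      perfect A⊆∁X A-perfect , ≤-trans ωB<ω (ω-mono ⊆⊤)
      where
      A⊆∁X : A ⊆ ∁ X
      A⊆∁X = subst (_ ∈_) A∪B≡∁X ∘ p⊆p∪q B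

      B⊆∁X : B ⊆ ∁ X
      B⊆∁X = subst (_ ∈_) A∪B≡∁X ∘ q⊆p∪q A B

      cover : (A ∪ X) ∪ B ≡ ⊤
      cover = ⊆-antisym ⊆⊤ λ {y} _ → covered y
        where
        covered : ∀ y → y ∈ (A ∪ X) ∪ B
        covered y with y ∈? X
        ... | yes y∈X = p⊆p∪q B (q⊆p∪q A X y∈X)
        ... | no  y∉X with x∈p∪q⁻ A B (subst (y ∈_) (sym A∪B≡∁X) (x∉p⇒x∈∁p y∉X))
        ...   | inj₁ y∈A = p⊆p∪q B (p⊆p∪q X y∈A)
        ...   | inj₂ y∈B = q⊆p∪q (A ∪ X) B y∈B

      disjoint : Empty ((A ∪ X) ∩ B)
      disjoint (y , y∈) with x∈p∩q⁻ (A ∪ X) B y∈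
      ... | y∈A∪X , y∈B with x∈p∪q⁻ A X y∈A∪X
      ...   | inj₁ y∈A = A∩B=∅ (y , x∈p∩q⁺ (y∈A , y∈B))
      ...   | inj₂ y∈X = x∈∁p⇒x∉p (B⊆∁X y∈B) y∈X

    divisible : PerfectlyDivisible G ⊤
    divisible T _ edge with T ⊂? ⊤
    ... | yes T⊂⊤ = minimal T T⊂⊤ T ⊆-refl edge
    ... | no  T⊄⊤ = subst (λ S → ∃₂ λ A B → GoodPartition G S A B) (sym T≡⊤) good-partition
      where
      T≡⊤ : T ≡ ⊤
      T≡⊤ = ⊆-antisym ⊆⊤ λ {y} _ →
        decidable-stable (y ∈? T) λ y∉T → T⊄⊤ (⊆⊤ , y , ∈⊤ , y∉T)

  -- Stable sets and clique cutsets

  NonadjacentPair : Subset n → Set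
  NonadjacentPair S = ∃₂ λ u v → u ∈ S × v ∈ S × u ≢ v × ¬ Adj G u v

  clique-or-nonadjacent-pair : ∀ S → IsClique G S ⊎ NonadjacentPair S
  clique-or-nonadjacent-pair S with any? (λ u → any? (λ v →
    (u ∈? S) ×-dec (v ∈? S) ×-dec ¬? (u ≟ v) ×-dec ¬? (adj? G u v)))
  ... | yes pair = inj₂ pair
  ... | no ¬pair = inj₁ λ u v u∈ v∈ u≢v →
    decidable-stable (adj? G u v) λ ¬uv → ¬pair (u , v , u∈ , v∈ , u≢v , ¬uv)

  isStable-∪ : ∀ {K L} → IsStable G K → IsStable G L →
               (∀ x y → x ∈ K → y ∈ L → ¬ Adj G x y) → IsStable G (K ∪ L)
  isStable-∪ {K} {L} sK sL sKL u v u∈ v∈ with x∈p∪q⁻ K L u∈ | x∈p∪q⁻ K L v∈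
  ... | inj₁ u∈K | inj₁ v∈K = sK u v u∈K v∈K
  ... | inj₁ u∈K | inj₂ v∈L = sKL u v u∈K v∈L
  ... | inj₂ u∈L | inj₁ v∈K = sKL v u v∈K u∈L ∘ adj-sym G
  ... | inj₂ u∈L | inj₂ v∈L = sL u v u∈L v∈L

  isStable-⁅⁆ : ∀ x → IsStable G ⁅ x ⁆
  isStable-⁅⁆ x u v u∈ v∈ = adj-irrefl G (trans (x∈⁅y⁆⇒x≡y x u∈) (sym (x∈⁅y⁆⇒x≡y x v∈)))

  nonadjacent-pair⇒stable : ∀ {S} → NonadjacentPair S →
                            ∃[ K ] (K ⊆ S × IsStable G K × ∣ K ∣ ≡ 2)
  nonadjacent-pair⇒stable {S} (u , v , u∈ , v∈ , u≢v , ¬uv) = ⁅ u ⁆ ∪ ⁅ v ⁆ , ⊆S ,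
    isStable-∪ (isStable-⁅⁆ u) (isStable-⁅⁆ v) nonadjacent ,
    trans (disjoint⇒∣p∪q∣≡∣p∣+∣q∣ ⁅ u ⁆ ⁅ v ⁆
            λ x∈u x∈v → u≢v (trans (sym (x∈⁅y⁆⇒x≡y u x∈u)) (x∈⁅y⁆⇒x≡y v x∈v)))
          (cong₂ _+_ (∣⁅x⁆∣≡1 u) (∣⁅x⁆∣≡1 v))
    where
    ⊆S : ⁅ u ⁆ ∪ ⁅ v ⁆ ⊆ S
    ⊆S x∈ with x∈p∪q⁻ ⁅ u ⁆ ⁅ v ⁆ x∈
    ... | inj₁ x∈u = subst (_∈ S) (sym (x∈⁅y⁆⇒x≡y u x∈u)) u∈
    ... | inj₂ x∈v = subst (_∈ S) (sym (x∈⁅y⁆⇒x≡y v x∈v)) v∈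

    nonadjacent : ∀ x y → x ∈ ⁅ u ⁆ → y ∈ ⁅ v ⁆ → ¬ Adj G x y
    nonadjacent x y x∈ y∈ xy with x∈⁅y⁆⇒x≡y u x∈ | x∈⁅y⁆⇒x≡y v y∈
    ... | refl | refl = ¬uv xy

  -- If neither side were a clique, a nonadjacent pair from each would together form a stable set of
  -- size four.
  4K₁-free⇒clique-side : 4K₁-Free G → ∀ {X Y} → (∀ {x} → x ∈ X → x ∉ Y) →
    (∀ x y → x ∈ X → y ∈ Y → ¬ Adj G x y) → IsClique G X ⊎ IsClique G Y
  4K₁-free⇒clique-side free {X} {Y} X∩Y=∅ anticomplete
    with clique-or-nonadjacent-pair X | clique-or-nonadjacent-pair Y
  ... | inj₁ cX | _       = inj₁ cX
  ... | inj₂ _  | inj₁ cY = inj₂ cY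
  ... | inj₂ pX | inj₂ pY with nonadjacent-pair⇒stable pX | nonadjacent-pair⇒stable pY
  ...   | K , K⊆X , sK , ∣K∣≡2 | L , L⊆Y , sL , ∣L∣≡2 = contradiction
    ( K ∪ L
    , isStable-∪ sK sL (λ x y x∈ y∈ → anticomplete x y (K⊆X x∈) (L⊆Y y∈))
    , trans (disjoint⇒∣p∪q∣≡∣p∣+∣q∣ K L λ x∈K x∈L → X∩Y=∅ (K⊆X x∈K) (L⊆Y x∈L))
            (cong₂ _+_ ∣K∣≡2 ∣L∣≡2))
    free

  -- Closure makes `X` a union of components of `G` minus `C`, with no edges to `∁ C ─ X`. Hence
  -- either side sends its outside edges only into `C`; `u` and `v` show that both are nonempty.
  separated⇒⊥ : 4K₁-Free G → MinimallyNonPerfectlyDivisible G → ∀ {C X u v} → IsClique G C →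
    X ⊆ ∁ C → u ∈ X → v ∈ ∁ C → v ∉ X →
    (∀ x y → x ∈ X → y ∈ ∁ C → Adj G x y → y ∈ X) → Data.Empty.⊥
  separated⇒⊥ free mnpd {C} {X} {u} {v} cC X⊆∁C u∈X v∈∁C v∉X closed
    with 4K₁-free⇒clique-side free {X} {∁ C ─ X}
      (λ x∈X x∈Y → x∈p─q⇒x∉q (∁ C) X x∈Y x∈X)
      (λ x y x∈X y∈Y xy → x∈p─q⇒x∉q (∁ C) X y∈Y (closed x y x∈X (p─q⊆p (∁ C) X y∈Y) xy))
  ... | inj₁ cX = clique-with-clique-attachment⇒⊥ mnpd cX (u , u∈X) cC
    λ x a x∈X a∉X xa → x∉∁p⇒x∈p λ a∈∁C → a∉X (closed x a x∈X a∈∁C xa)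
  ... | inj₂ cY = clique-with-clique-attachment⇒⊥ mnpd cY
    (v , x∈p∧x∉q⇒x∈p─q v∈∁C v∉X) cC
    λ y a y∈Y a∉Y ya → x∉∁p⇒x∈p λ a∈∁C → a∉Y (x∈p∧x∉q⇒x∈p─q a∈∁C
      λ a∈X → x∈p─q⇒x∉q (∁ C) X y∈Y (closed a y a∈X (p─q⊆p (∁ C) X y∈Y) (adj-sym G ya)))

-- Double negation is an applicative functor, so it commutes with quantification over a finite type.
¬¬-sequence : {P : Pred (Fin n) 0ℓ} → (∀ i → ¬ ¬ P i) → ¬ ¬ (∀ i → P i)
¬¬-sequence = sequence (RawMonad.rawApplicative ¬¬-Monad)

theorem3 : ∀ {n : ℕ} (G : Graph n) → 4K₁-Free G → MinimallyNonPerfectlyDivisible G → ¬ (∃[ C ] IsCliqueCutset G C)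
theorem3 G free mnpd (C , cC , ¬connected) =
  ¬¬-sequence (λ u → ¬¬-sequence (linked u)) ¬connected
  where
  -- Reachability need not be decided: the goal is a negation.
  linked : ∀ u v → ¬ ¬ (u ∈ ∁ C → v ∈ ∁ C → Star (AdjIn G (∁ C)) u v)
  linked u v ¬link = ¬¬-sequence (λ _ → ¬¬-excluded-middle) separate
    where
    -- Deciding reachability from `u` for all `w` at once turns the component of `u` into a
    -- `Subset`. It contains `u` by the empty path and is closed because a path can be prolonged by
    -- an edge.
    separate : ¬ (∀ w → Dec (Star (AdjIn G (∁ C)) u w))
    separate reachable? = ¬link λ u∈ v∈ → decidable-stable (reachable? v) λ unreachable →
      separated⇒⊥ G free mnpd cC
        (p∩q⊆p (∁ C) ⟦ reachable? ⟧)
        (x∈p∩q⁺ (u∈ , ∈⟦⟧⁺ reachable? ε)) v∈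
        (λ v∈X → unreachable (∈⟦⟧⁻ reachable? (p∩q⊆q (∁ C) _ v∈X)))
        λ x y x∈X y∈ xy → x∈p∩q⁺ (y∈ , ∈⟦⟧⁺ reachable?
          (∈⟦⟧⁻ reachable? (p∩q⊆q (∁ C) _ x∈X) ◅◅ (p∩q⊆p (∁ C) _ x∈X , y∈ , xy) ◅ ε))
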